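{- There is an algorithm that, given strings $A,B$ and a common supersequence $S$ of $A$ and $B$, computes a minimal common supersequence $S'$ of $A$ and $B$ with $S'\subseteq S$ in $O(|S|+|A|+|B|)$ time.
   Context: $X\subseteq S$ means $X$ is a (not necessarily contiguous) subsequence of $S$. A common supersequence of $A$ and $B$ is a string $C$ with $A\subseteq C$ and $B\subseteq C$; it is minimal if no proper subsequence of $C$ is a common supersequence of $A$ and $B$. Time is measured in the standard RAM model with $O(1)$-time character comparisons. -}

module Defs where

open import Data.Bool.Base using (Bool; if_then_else_)
open import Data.Fin.Base using (Fin)
open import Data.List.Base using (List; []; _∷_; _++_; length; head; drop; fromMaybe)
open import Data.List.Relation.Binary.Sublist.Propositional using (_⊆_)
open import Data.Maybe.Base using (Maybe; just; nothing)
open import Data.Maybe.Properties using (≡-dec)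
open import Data.Nat.Base using (ℕ; zero; suc; _+_; _*_; _∸_; _≤_; _<ᵇ_; _≡ᵇ_)
open import Data.Product.Base using (∃-syntax; _×_)
open import Data.Vec.Base using (Vec; lookup; replicate; _[_]≔_)
open import Relation.Binary.Definitions using (DecidableEquality)
open import Relation.Binary.PropositionalEquality using (_≡_; _≢_)
open import Relation.Nullary using (¬_; does)

------------------------------------------------------------------------
-- Common supersequences

CommonSupersequence : {Char : Set} → (A B C : List Char) → Set
CommonSupersequence A B C = A ⊆ C × B ⊆ C

MinimalCommonSupersequence : {Char : Set} → (A B C : List Char) → Set
MinimalCommonSupersequence A B C =
  CommonSupersequence A B C ×
  (∀ X → X ⊆ C → X ≢ C → ¬ CommonSupersequence A B X)

------------------------------------------------------------------------
-- Growth of running times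

infix 4 _∈O_

_∈O_ : (ℕ → ℕ) → (ℕ → ℕ) → Set
f ∈O g = ∃[ c ] ∃[ n₀ ] (∀ n → n₀ ≤ n → f n ≤ c * g n)

------------------------------------------------------------------------
-- A unit-cost random access machine over an abstract alphabet
--
-- The machine has finitely many number registers, a random access memory
-- of numbers, a random access memory of characters and a write-only
-- output tape of characters. Arithmetic is limited to addition and
-- truncated subtraction, so that charging one step per instruction is
-- reasonable. Programs cannot mention specific characters: they can only
-- compare two character cells for equality, copy one cell to another, and
-- print a cell. In particular a program does not depend on the alphabet.

data Instruction (k : ℕ) : Set where
  const      : (dst : Fin k) (n : ℕ) → Instruction k
  move       : (dst src : Fin k) → Instruction k
  add        : (dst x y : Fin k) → Instruction k
  sub        : (dst x y : Fin k) → Instruction k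
  load       : (dst addr : Fin k) → Instruction k
  store      : (addr src : Fin k) → Instruction k
  jump       : (target : ℕ) → Instruction k
  jump<      : (x y : Fin k) (target : ℕ) → Instruction k
  -- The remaining instructions address character cells by registers.
  jumpSame   : (addr₁ addr₂ : Fin k) (target : ℕ) → Instruction k
  copyChar   : (dstAddr srcAddr : Fin k) → Instruction k
  printChar  : (addr : Fin k) → Instruction k

record Program : Set where
  constructor program
  field
    registers : ℕ
    code      : List (Instruction registers)

update : {V : Set} → (ℕ → V) → ℕ → V → ℕ → V
update m i v j = if i ≡ᵇ j then v else m j

module Machine {Char : Set} (_≟_ : DecidableEquality Char) where

  -- A character cell holding `nothing` is blank.
  record State (k : ℕ) : Set where
    constructor state
    field
      pc     : ℕ
      regs   : Vec ℕ k
      words  : ℕ → ℕ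
      chars  : ℕ → Maybe Char
      output : List Char

  open State public

  sameCell : Maybe Char → Maybe Char → Bool
  sameCell x y = does (≡-dec _≟_ x y)

  -- Printing a blank cell prints nothing.
  execute : ∀ {k} → Instruction k → State k → State k
  execute (const d n)      (state pc r w c o) = state (suc pc) (r [ d ]≔ n) w c o
  execute (move d x)       (state pc r w c o) = state (suc pc) (r [ d ]≔ lookup r x) w c o
  execute (add d x y)      (state pc r w c o) = state (suc pc) (r [ d ]≔ (lookup r x + lookup r y)) w c o
  execute (sub d x y)      (state pc r w c o) = state (suc pc) (r [ d ]≔ (lookup r x ∸ lookup r y)) w c o
  execute (load d a)       (state pc r w c o) = state (suc pc) (r [ d ]≔ w (lookup r a)) w c o
  execute (store a x)      (state pc r w c o) = state (suc pc) r (update w (lookup r a) (lookup r x)) c o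
  execute (jump t)         (state pc r w c o) = state t r w c o
  execute (jump< x y t)    (state pc r w c o) =
    state (if lookup r x <ᵇ lookup r y then t else suc pc) r w c o
  execute (jumpSame a b t) (state pc r w c o) =
    state (if sameCell (c (lookup r a)) (c (lookup r b)) then t else suc pc) r w c o
  execute (copyChar a b)   (state pc r w c o) = state (suc pc) r w (update c (lookup r a) (c (lookup r b))) o
  execute (printChar a)    (state pc r w c o) = state (suc pc) r w c (o ++ fromMaybe (c (lookup r a)))

  module _ (P : Program) where
    open Program P

    fetch : ℕ → Maybe (Instruction registers)
    fetch i = head (drop i code)

    -- The machine halts when the program counter leaves the program.
    Halted : State registers → Set
    Halted s = fetch (pc s) ≡ nothing

    step : State registers → State registers
    step s with fetch (pc s)
    ... | just i  = execute i s
    ... | nothing = s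

    run : ℕ → State registers → State registers
    run zero    s = s
    run (suc t) s = run t (step s)

    -- The inputs A, B, S are stored consecutively from character cell 0 on,
    -- and their lengths are stored in words 0, 1, 2. All registers and all
    -- other words are 0, and all other character cells are blank.
    initial : (A B S : List Char) → State registers
    initial A B S = record
      { pc     = 0
      ; regs   = replicate registers 0
      ; words  = λ { 0 → length A ; 1 → length B ; 2 → length S ; _ → 0 }
      ; chars  = λ i → head (drop i (A ++ B ++ S))
      ; output = []
      }

    OutputsWithin : (T : ℕ) (A B S S′ : List Char) → Set
    OutputsWithin T A B S S′ =
      ∃[ t ] (t ≤ T ×
              Halted (run t (initial A B S)) ×
              output (run t (initial A B S)) ≡ S′)

{-# OPTIONS --safe #-}

-- Scan S from left to right and delete a character whenever what remains of A
-- and of B still embeds in what remains of S; otherwise keep it and match it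
-- greedily against A and B. A kept character stays necessary when later ones
-- are deleted, so one pass gives a minimal common supersequence.
-- A suffix `drop p A` embeds in a suffix of S iff p is at least a threshold
-- depending on that suffix only, and a right-to-left pass tabulates the
-- thresholds in linear time. Treating B as a suffix of A ++ B and S as a suffix
-- of A ++ B ++ S makes all list positions coincide with memory addresses.

module Submission where

open import Defs
open import Data.Bool.Base using (true; false; if_then_else_)
open import Data.Fin using (Fin; #_)
open import Data.List.Base using (List; []; _∷_; _++_; length; head; drop; fromMaybe)
open import Data.List.Properties using (++-assoc; ++-identityʳ; length-++; drop-all)
open import Data.List.Relation.Binary.Sublist.Propositional
  using (_⊆_; []; _∷_; _∷ʳ_; minimum; ⊆-refl; ⊆-trans)
open import Data.List.Relation.Binary.Sublist.Propositional.Properties using (∷ʳ⁻)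
open import Data.Maybe.Base using (Maybe; just)
open import Data.Nat.Base using (ℕ; zero; suc; _+_; _*_; _∸_; _≤_; _<_; _≡ᵇ_; z≤n; s≤s)
open import Data.Nat.Properties
open import Data.Nat.Tactic.RingSolver using (solve-∀)
open import Data.Product.Base using (Σ; ∃-syntax; _×_; _,_; proj₁; proj₂)
open import Data.Sum.Base using (_⊎_; inj₁; inj₂)
open import Data.Vec.Base using ([]; _∷_)
open import Function.Base using (id; _∘_)
open import Relation.Binary.Definitions using (DecidableEquality)
open import Relation.Binary.PropositionalEquality
open import Relation.Nullary using (¬_; does; yes; no; contradiction)
open import Relation.Nullary.Reflects using (Reflects; ofʸ; ofⁿ; det)

-- Suffixes, cost bounds and memory updates.

drop-length-++ : ∀ {C : Set} (L R : List C) → drop (length L) (L ++ R) ≡ R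
drop-length-++ []      R = refl
drop-length-++ (_ ∷ L) R = drop-length-++ L R

drop-< : ∀ {C : Set} {p} (L : List C) → p < length L →
         ∃[ x ] drop p L ≡ x ∷ drop (suc p) L
drop-< {p = zero}  (x ∷ L) _         = x , refl
drop-< {p = suc p} (x ∷ L) (s≤s p<n) = drop-< L p<n

drop-[]⇒≥ : ∀ {C : Set} p {L : List C} → drop p L ≡ [] → length L ≤ p
drop-[]⇒≥ p       {[]}    _  = z≤n
drop-[]⇒≥ (suc p) {_ ∷ L} eq = s≤s (drop-[]⇒≥ p eq)

drop-∷⇒< : ∀ {C : Set} p {L : List C} {x l} → drop p L ≡ x ∷ l → p < length L
drop-∷⇒< zero    {_ ∷ L} _  = s≤s z≤n
drop-∷⇒< (suc p) {_ ∷ L} eq = s≤s (drop-∷⇒< p eq)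

drop-suc : ∀ {C : Set} p (L : List C) {l} → drop p L ≡ l → drop (suc p) L ≡ drop 1 l
drop-suc zero    L       refl = refl
drop-suc (suc p) []      refl = refl
drop-suc (suc p) (_ ∷ L) eq   = drop-suc p L eq

-- Charges one loop iteration of cost `k` to a budget of `c` per iteration.
amortise : ∀ c n {k} → k ≤ c → k + c * n ≤ c * suc n
amortise c n k≤c = ≤-trans (+-monoˡ-≤ (c * n) k≤c) (≤-reflexive (sym (*-suc c n)))

update-same : ∀ {V : Set} (m : ℕ → V) i v → update m i v i ≡ v
update-same m i v with i ≡ᵇ i | ≡⇒≡ᵇ i i refl
... | true | _ = refl

update-other : ∀ {V : Set} (m : ℕ → V) {i j} v → i ≢ j → update m i v j ≡ m j
update-other m {i} {j} v i≢j with i ≡ᵇ j | ≡ᵇ⇒≡ i j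
... | true  | eq = contradiction (eq _) i≢j
... | false | _  = refl

-- Thresholds for embedding suffixes.

module _ {Char : Set} where

  -- Cells past the end of `L` are unconstrained, so `A`, `A ++ B` and `A ++ B ++ S` can all be
  -- stored from cell 0 in the same memory.
  Stores : (ℕ → Maybe Char) → List Char → Set
  Stores c L = ∀ p {y l} → drop p L ≡ y ∷ l → c p ≡ just y

  stores-++ : ∀ L R → Stores (λ i → head (drop i (L ++ R))) L
  stores-++ (x ∷ L) R zero    refl = refl
  stores-++ (x ∷ L) R (suc p) eq   = stores-++ L R p eq

  Threshold : List Char → List Char → ℕ → Set
  Threshold L s j = j ≤ length L × (∀ p → drop p L ⊆ s → j ≤ p) × (∀ p → j ≤ p → drop p L ⊆ s)

  threshold-[] : ∀ L → Threshold L [] (length L)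
  threshold-[] L = ≤-refl
                 , (λ p dp⊆ → drop-[]⇒≥ p (⊆[]⇒≡[] dp⊆))
                 , (λ p n≤p → subst (_⊆ []) (sym (drop-all p L n≤p)) [])
    where
    ⊆[]⇒≡[] : ∀ {l : List Char} → l ⊆ [] → l ≡ []
    ⊆[]⇒≡[] [] = refl

  -- The extra `x` can match at most one character, so a threshold falls by at most one when `x` is
  -- prepended.
  drop-suc-⊆ : ∀ p (L : List Char) {x s} → drop p L ⊆ x ∷ s → drop (suc p) L ⊆ s
  drop-suc-⊆ p L d⊆ with drop p L in eq
  drop-suc-⊆ p L d⊆             | []    = subst (_⊆ _) (sym (drop-suc p L eq)) (minimum _)
  drop-suc-⊆ p L (_ ∷ʳ y∷l⊆s)   | y ∷ l = subst (_⊆ _) (sym (drop-suc p L eq)) (⊆-trans (y ∷ʳ ⊆-refl) y∷l⊆s)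
  drop-suc-⊆ p L (_ ∷ l⊆s)      | y ∷ l = subst (_⊆ _) (sym (drop-suc p L eq)) l⊆s

  minimal-[] : {A B : List Char} → A ⊆ [] → B ⊆ [] → MinimalCommonSupersequence A B []
  minimal-[] [] [] = ([] , []) , λ { [] [] []≢[] _ → []≢[] refl }

  module _ (_≟_ : DecidableEquality Char) where
    open Machine _≟_ using (sameCell)

    -- Nothing guards against the start of `L`: a threshold 0 can only be
    -- replaced by 0 ∸ 1 = 0.
    threshold-∷ : ∀ {c L x s i j} → Stores c L → c i ≡ just x → Threshold L s j →
                  Threshold L (x ∷ s) (if sameCell (c (j ∸ 1)) (c i) then j ∸ 1 else j)
    threshold-∷ {c} {i = i} {zero} _ _ (_ , _ , ⊆s) with sameCell (c 0) (c i)
    ... | true  = z≤n , (λ _ _ → z≤n) , (λ p 0≤p → _ ∷ʳ ⊆s p 0≤p)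
    ... | false = z≤n , (λ _ _ → z≤n) , (λ p 0≤p → _ ∷ʳ ⊆s p 0≤p)
    threshold-∷ {c} {L} {x} {s} {i} {suc k} stores ci (k<n , ≤p , ⊆s)
      with y , eq ← drop-< L k<n
      rewrite ci | stores k eq with y ≟ x
    ... | yes refl = <⇒≤ k<n , (λ p d⊆ → ≤-pred (≤p (suc p) (drop-suc-⊆ p L d⊆))) , from
      where
      from : ∀ p → k ≤ p → drop p L ⊆ x ∷ s
      from p k≤p with m≤n⇒m<n∨m≡n k≤p
      ... | inj₁ k<p  = x ∷ʳ ⊆s p k<p
      ... | inj₂ refl = subst (_⊆ x ∷ s) (sym eq) (refl ∷ ⊆s (suc k) ≤-refl)
    ... | no y≢x = k<n , to , (λ p k<p → x ∷ʳ ⊆s p k<p)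
      where
      to : ∀ p → drop p L ⊆ x ∷ s → k < p
      to p d⊆ with m≤n⇒m<n∨m≡n (≤-pred (≤p (suc p) (drop-suc-⊆ p L d⊆)))
      ... | inj₁ k<p  = k<p
      -- The mismatching head `y` forces `x` to be skipped, so the suffix at `k` already embeds in
      -- `s`, below the threshold `suc k`.
      ... | inj₂ refl = ≤p k (subst (_⊆ s) (sym eq) (∷ʳ⁻ y≢x (subst (_⊆ x ∷ s) eq d⊆)))

    -- Greedy matching and minimality.

    consume : Char → List Char → List Char
    consume x []      = []
    consume x (y ∷ l) = if does (y ≟ x) then l else y ∷ l

    -- Matching as early as possible loses nothing: an embedding that skips `x` restricts to one of
    -- the tail.
    consume-⊆ : ∀ {x l s} → l ⊆ x ∷ s → consume x l ⊆ s
    consume-⊆ {l = []} _ = minimum _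
    consume-⊆ {x} {y ∷ l} yl⊆ with y ≟ x
    consume-⊆ (_ ∷ʳ yl⊆s)   | yes _  = ⊆-trans (_ ∷ʳ ⊆-refl) yl⊆s
    consume-⊆ (_ ∷ l⊆s)     | yes _  = l⊆s
    consume-⊆ yl⊆           | no y≢x = ∷ʳ⁻ y≢x yl⊆

    consume-⊆⁻ : ∀ {x l s} → consume x l ⊆ s → l ⊆ x ∷ s
    consume-⊆⁻ {l = []} _ = minimum _
    consume-⊆⁻ {x} {y ∷ l} c⊆ with y ≟ x
    ... | yes y≡x = y≡x ∷ c⊆
    ... | no  _   = x ∷ʳ c⊆

    -- Past the end of `L` the comparison is junk, but both of its outcomes
    -- leave the empty suffix.
    drop-consume : ∀ {c L x i} p → Stores c L → c i ≡ just x →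
                   drop (if sameCell (c p) (c i) then suc p else p) L ≡ consume x (drop p L)
    drop-consume {c} {L} {x} {i} p stores ci with drop p L in eq
    drop-consume {c} {L} {x} {i} p stores ci | [] with sameCell (c p) (c i)
    ... | true  = drop-suc p L eq
    ... | false = eq
    drop-consume {c} {L} {x} {i} p stores ci | y ∷ l rewrite ci | stores p eq with does (y ≟ x)
    ... | true  = drop-suc p L eq
    ... | false = eq

    -- A competitor without this `x` lies inside `R`, hence inside `s`, which is ruled out; one that
    -- keeps it is compared with `R` after removing `x`. Necessity is stated for `s`, so it can be
    -- tested before `R` is known.
    minimal-∷ : ∀ {A B x R s} → ¬ (A ⊆ s × B ⊆ s) → R ⊆ s →
                MinimalCommonSupersequence (consume x A) (consume x B) R →
                MinimalCommonSupersequence A B (x ∷ R)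
    minimal-∷ {A} {B} {x} {R} needed R⊆s ((A⊆R , B⊆R) , min) =
      (consume-⊆⁻ A⊆R , consume-⊆⁻ B⊆R) , min′
      where
      min′ : ∀ X → X ⊆ x ∷ R → X ≢ x ∷ R → ¬ CommonSupersequence A B X
      min′ X (_ ∷ʳ X⊆R) _ (A⊆X , B⊆X) =
        needed (⊆-trans A⊆X (⊆-trans X⊆R R⊆s) , ⊆-trans B⊆X (⊆-trans X⊆R R⊆s))
      min′ (x ∷ X) (refl ∷ X⊆R) X≢ (A⊆X , B⊆X) =
        min X X⊆R (X≢ ∘ cong (x ∷_)) (consume-⊆ A⊆X , consume-⊆ B⊆X)

-- The program.

-- The registers `la` and `m` keep the initial positions of B and S, and `off`
-- is the distance between the tables for A and for A ++ B.
minimise : Program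
minimise = program 9
  ( load p i           -- 0
  ∷ move la p
  ∷ const one 1
  ∷ load q one
  ∷ add q p q
  ∷ move m q
  -- Forms 2, the address of the length of S.
  ∷ add i one one
  ∷ load i i
  ∷ add i q i
  -- With `N` the total input length, each table has `N + 1` entries, the last for the empty suffix.
  -- The tables overwrite the input lengths, which have been read by now.
  ∷ add off one i
  ∷ store i p          -- 10: tabulate the thresholds from right to left
  ∷ add t i off
  ∷ store t q
  ∷ jump< i one 24
  ∷ sub i i one
  ∷ sub t p one
  ∷ jumpSame t i 18
  ∷ move t p
  ∷ move p t
  ∷ sub t q one
  ∷ jumpSame t i 22
  ∷ move t q
  ∷ move q t
  ∷ jump 10
  ∷ const p 0          -- 24
  ∷ move q la
  ∷ move i m
  ∷ add t one i        -- 27: scan S from left to right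
  ∷ jump< t off 30
  ∷ jump 47
  ∷ load u t           -- 30: is the current character needed?
  ∷ jump< p u 36
  ∷ add u t off
  ∷ load u u
  ∷ jump< q u 36
  ∷ jump 45
  ∷ printChar i        -- 36: yes
  ∷ add u one p
  ∷ jumpSame p i 40
  ∷ move u p
  ∷ move p u
  ∷ add u one q
  ∷ jumpSame q i 44
  ∷ move u q
  ∷ move q u
  ∷ move i t           -- 45
  ∷ jump 27
  ∷ [])
  where
  one i p q la m off t u : Fin 9
  one = # 0
  i   = # 1
  p   = # 2
  q   = # 3
  la  = # 4
  m   = # 5
  off = # 6
  t   = # 7
  u   = # 8

-- Symbolic execution.

module _ {Char : Set} (_≟_ : DecidableEquality Char) where
  open Machine _≟_

  infix 4 _↝[_]_
  infixr 5 _▷_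

  _↝[_]_ : State 9 → ℕ → State 9 → Set
  s ↝[ n ] s′ = ∃[ t ] (t ≤ n × run minimise t s ≡ s′)

  run-+ : ∀ m n s → run minimise (m + n) s ≡ run minimise n (run minimise m s)
  run-+ zero    n s = refl
  run-+ (suc m) n s = run-+ m n (step minimise s)

  _▷_ : ∀ {s s′ s″ m n} → s ↝[ m ] s′ → s′ ↝[ n ] s″ → s ↝[ m + n ] s″
  _▷_ {s} (a , a≤m , refl) (b , b≤n , refl) = a + b , +-mono-≤ a≤m b≤n , run-+ a b s

  -- The code is concrete, so straight-line stretches and resolved jumps hold by evaluation; only
  -- undecided tests need an argument.
  steps : ∀ n {s} → s ↝[ n ] run minimise n s
  steps n = n , ≤-refl , refl

  weaken : ∀ {s s′ m n} → m ≤ n → s ↝[ m ] s′ → s ↝[ n ] s′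
  weaken m≤n (a , a≤m , eq) = a , ≤-trans a≤m m≤n , eq

  module Run (c : ℕ → Maybe Char) (la m N : ℕ) where

    conf : (pc i p q t u : ℕ) → (ℕ → ℕ) → List Char → State 9
    conf pc i p q t u w o = state pc (1 ∷ i ∷ p ∷ q ∷ la ∷ m ∷ suc N ∷ t ∷ u ∷ []) w c o

    -- Shaped exactly as in `threshold-∷` and `drop-consume`, so that these apply without rewriting.
    retreated advanced : ℕ → ℕ → ℕ
    retreated i p = if sameCell (c (p ∸ 1)) (c i) then p ∸ 1 else p
    advanced  i p = if sameCell (c p) (c i) then suc p else p

    retreat-p : ∀ i p q t u w o →
      conf 15 i p q t u w o ↝[ 4 ] conf 19 i (retreated i p) q (retreated i p) u w o
    retreat-p i p q t u w o = steps 2 ▷ finish (sameCell (c (p ∸ 1)) (c i))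
      where
      -- Generalising the test to a variable lets each branch evaluate.
      finish : ∀ b → let p′ = if b then p ∸ 1 else p in
        conf (if b then 18 else 17) i p q (p ∸ 1) u w o ↝[ 2 ] conf 19 i p′ q p′ u w o
      finish true  = weaken (s≤s z≤n) (steps 1)
      finish false = steps 2

    retreat-q : ∀ i p q t u w o →
      conf 19 i p q t u w o ↝[ 4 ] conf 23 i p (retreated i q) (retreated i q) u w o
    retreat-q i p q t u w o = steps 2 ▷ finish (sameCell (c (q ∸ 1)) (c i))
      where
      finish : ∀ b → let q′ = if b then q ∸ 1 else q in
        conf (if b then 22 else 21) i p q (q ∸ 1) u w o ↝[ 2 ] conf 23 i p q′ q′ u w o
      finish true  = weaken (s≤s z≤n) (steps 1)
      finish false = steps 2

    advance-p : ∀ i p q t u w o →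
      conf 37 i p q t u w o ↝[ 4 ] conf 41 i (advanced i p) q t (advanced i p) w o
    advance-p i p q t u w o = steps 2 ▷ finish (sameCell (c p) (c i))
      where
      finish : ∀ b → let p′ = if b then suc p else p in
        conf (if b then 40 else 39) i p q t (suc p) w o ↝[ 2 ] conf 41 i p′ q t p′ w o
      finish true  = weaken (s≤s z≤n) (steps 1)
      finish false = steps 2

    advance-q : ∀ i p q t u w o →
      conf 41 i p q t u w o ↝[ 4 ] conf 45 i p (advanced i q) t (advanced i q) w o
    advance-q i p q t u w o = steps 2 ▷ finish (sameCell (c q) (c i))
      where
      finish : ∀ b → let q′ = if b then suc q else q in
        conf (if b then 44 else 43) i p q t (suc q) w o ↝[ 2 ] conf 45 i p q′ t q′ w o
      finish true  = weaken (s≤s z≤n) (steps 1)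
      finish false = steps 2

    continue : ∀ i p q t u w o → i < N →
      conf 27 i p q t u w o ↝[ 2 ] conf 30 i p q (suc i) u w o
    continue i p q t u w o i<N = 2 , ≤-refl ,
      -- The machine tests `suc i` against `off`, that is `suc N`, which reduces to `i <ᵇ N`.
      cong (λ b → conf (if b then 30 else 29) i p q (suc i) u w o)
        (det (<ᵇ-reflects-< i N) (ofʸ i<N))

    stop : ∀ i p q t u w o → N ≤ i →
      conf 27 i p q t u w o ↝[ 3 ] conf 47 i p q (suc i) u w o
    stop i p q t u w o N≤i = (2 , ≤-refl ,
      cong (λ b → conf (if b then 30 else 29) i p q (suc i) u w o)
        (det (<ᵇ-reflects-< i N) (ofⁿ (≤⇒≯ N≤i)))) ▷ steps 1

    keep : ∀ i p q t u w o →
      conf 36 i p q t u w o ↝[ 11 ]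
      conf 27 t (advanced i p) (advanced i q) t (advanced i q) w (o ++ fromMaybe (c i))
    keep i p q t u w o = steps 1 ▷ advance-p i p q t u w _ ▷ advance-q i (advanced i p) q t _ w _ ▷ steps 2

    Decision : (i p q t u : ℕ) → (ℕ → ℕ) → List Char → Set
    Decision i p q t u w o =
      (∃[ u′ ] conf 30 i p q t u w o ↝[ 6 ] conf 36 i p q t u′ w o
        × ¬ (w t ≤ p × w (t + suc N) ≤ q))
      ⊎
      (∃[ u′ ] conf 30 i p q t u w o ↝[ 6 ] conf 45 i p q t u′ w o
        × w t ≤ p × w (t + suc N) ≤ q)

    decide : ∀ i p q t u w o → Decision i p q t u w o
    decide i p q t u w o = case-p (<ᵇ-reflects-< p (w t)) (steps 2)
      where
      v = w (t + suc N)

      -- Matching on the reflection proof fixes the jump target and yields the inequality together.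
      case-q : ∀ {b} → Reflects (q < v) b → w t ≤ p →
        conf 30 i p q t u w o ↝[ 5 ] conf (if b then 36 else 35) i p q t v w o →
        Decision i p q t u w o
      case-q (ofʸ q<v) _    r = inj₁ (v , weaken (n≤1+n 5) r , λ (_ , v≤q) → <⇒≱ q<v v≤q)
      case-q (ofⁿ q≮v) wt≤p r = inj₂ (v , (r ▷ steps 1) , wt≤p , ≮⇒≥ q≮v)

      case-p : ∀ {b} → Reflects (p < w t) b →
        conf 30 i p q t u w o ↝[ 2 ] conf (if b then 36 else 32) i p q t (w t) w o →
        Decision i p q t u w o
      case-p (ofʸ p<wt) r = inj₁ (w t , weaken (m≤n+m 2 4) r , λ (wt≤p , _) → <⇒≱ p<wt wt≤p)
      case-p (ofⁿ p≮wt) r = case-q (<ᵇ-reflects-< q v) (≮⇒≥ p≮wt) (r ▷ steps 3)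

    -- Invariants of the two loops.

    module Correctness (L M W : List Char) (|W|≡N : length W ≡ N)
             (storesL : Stores c L) (storesM : Stores c M) (storesW : Stores c W) where

      Table : ℕ → (ℕ → ℕ) → Set
      Table k w = ∀ i → k ≤ i → i ≤ N →
        Threshold L (drop i W) (w i) × Threshold M (drop i W) (w (i + suc N))

      -- Keeps the second table clear of the first.
      far : ∀ {a} b → a ≤ N → b + suc N ≢ a
      far b a≤N = <⇒≢ (≤-trans (s≤s a≤N) (m≤n+m (suc N) b)) ∘ sym

      table-∷ : ∀ {i p q w} → Threshold L (drop i W) p → Threshold M (drop i W) q → i ≤ N →
                Table (suc i) w → Table i (update (update w i p) (i + suc N) q)
      table-∷ {i} {p} {q} {w} thL thM i≤N table j i≤j j≤N with m≤n⇒m<n∨m≡n i≤j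
      ... | inj₁ i<j =
              subst (Threshold L _)
                (sym (trans (update-other (update w i p) q (far i j≤N)) (update-other w p (<⇒≢ i<j))))
                (proj₁ (table j i<j j≤N))
            , subst (Threshold M _)
                (sym (trans (update-other (update w i p) q (<⇒≢ (+-monoˡ-< (suc N) i<j)))
                            (update-other w p (far j i≤N ∘ sym))))
                (proj₂ (table j i<j j≤N))
      ... | inj₂ refl =
              subst (Threshold L _)
                (sym (trans (update-other (update w i p) q (far i i≤N)) (update-same w i p))) thL
            , subst (Threshold M _) (sym (update-same (update w i p) (i + suc N) q)) thM

      -- Induction on `i`, with the entries for `i` held in `p` and `q` but not yet written; `14` is
      -- the length of the loop body.
      tabulate : ∀ i p q t u w o → i ≤ N →
        Threshold L (drop i W) p → Threshold M (drop i W) q → Table (suc i) w →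
        ∃[ p′ ] ∃[ q′ ] ∃[ t′ ] ∃[ w′ ] (Table 0 w′ ×
          conf 10 i p q t u w o ↝[ 14 * suc i ] conf 24 0 p′ q′ t′ u w′ o)
      tabulate zero p q t u w o i≤N thL thM table =
        p , q , suc N , _ , table-∷ thL thM i≤N table , weaken (m≤n+m 4 10) (steps 4)
      tabulate (suc i) p q t u w o i<N thL thM table
        with x , eq ← drop-< W (subst (suc i ≤_) (sym |W|≡N) i<N)
        with p′ , q′ , t′ , w′ , table′ , reach ←
          tabulate i (retreated i p) (retreated i q) (retreated i q) u
            (update (update w (suc i) p) (suc i + suc N) q) o (<⇒≤ i<N)
            (subst (λ s → Threshold L s (retreated i p)) (sym eq) (threshold-∷ _≟_ storesL (storesW i eq) thL))
            (subst (λ s → Threshold M s (retreated i q)) (sym eq) (threshold-∷ _≟_ storesM (storesW i eq) thM))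
            (table-∷ thL thM i<N table)
        = p′ , q′ , t′ , w′ , table′ ,
          weaken (amortise 14 (suc i) ≤-refl)
            (steps 5 ▷ retreat-p i p q _ u _ o ▷ retreat-q i (retreated i p) q _ u _ o ▷ steps 1 ▷ reach)

      -- Both embeddings survive a deletion by the threshold test and a kept character by
      -- `consume-⊆`. A kept character costs `2 + 6 + 11 = 19` steps, a deleted one `10`.
      scan : ∀ s i p q t u w o → Table 0 w → drop i W ≡ s → drop p L ⊆ s → drop q M ⊆ s →
        ∃[ R ] (MinimalCommonSupersequence (drop p L) (drop q M) R × R ⊆ s ×
          ∃[ f ] (conf 27 i p q t u w o ↝[ 19 * suc (length s) ] f ×
                  Halted minimise f × output f ≡ o ++ R))
      scan [] i p q t u w o table eq L⊆ M⊆ =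
        [] , minimal-[] L⊆ M⊆ , [] , conf 47 i p q (suc i) u w o ,
        weaken (m≤n+m 3 16) (stop i p q t u w o (subst (_≤ i) |W|≡N (drop-[]⇒≥ i eq))) ,
        refl , sym (++-identityʳ o)
      scan (x ∷ s) i p q t u w o table eq L⊆ M⊆
        with i<N ← subst (i <_) |W|≡N (drop-∷⇒< i eq)
        -- The entry at `suc i` describes what follows the current character: `⇒L` and `⇒M` justify
        -- deletion, `L⇒` and `M⇒` necessity.
        with (_ , L⇒ , ⇒L) , (_ , M⇒ , ⇒M) ← subst
               (λ s → Threshold L s (w (suc i)) × Threshold M s (w (suc i + suc N)))
               (drop-suc i W eq) (table (suc i) z≤n i<N)
        with decide i p q (suc i) u w o
      ... | inj₂ (u′ , reach , ≤p , ≤q)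
        with R , min , R⊆s , f , reach′ , rest ←
          scan s (suc i) p q (suc i) u′ w o table (drop-suc i W eq) (⇒L p ≤p) (⇒M q ≤q)
        = R , min , x ∷ʳ R⊆s , f ,
          weaken (amortise 19 (suc (length s)) (m≤n+m 10 9)) (continue i p q t u w o i<N ▷ reach ▷ steps 2 ▷ reach′) , rest
      ... | inj₁ (u′ , reach , needed)
        with eqL ← drop-consume _≟_ p storesL (storesW i eq)
        with eqM ← drop-consume _≟_ q storesM (storesW i eq)
        with R , min , R⊆s , f , reach′ , halted , out ←
          scan s (suc i) (advanced i p) (advanced i q) (suc i) _ w (o ++ fromMaybe (c i)) table (drop-suc i W eq)
            (subst (_⊆ s) (sym eqL) (consume-⊆ _≟_ L⊆)) (subst (_⊆ s) (sym eqM) (consume-⊆ _≟_ M⊆))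
        = x ∷ R ,
          minimal-∷ _≟_ (λ (p⊆ , q⊆) → needed (L⇒ p p⊆ , M⇒ q q⊆)) R⊆s
            (subst₂ (λ A B → MinimalCommonSupersequence A B R) eqL eqM min) ,
          refl ∷ R⊆s , f ,
          weaken (amortise 19 (suc (length s)) ≤-refl) (continue i p q t u w o i<N ▷ reach ▷ keep i p q (suc i) u′ w o ▷ reach′) ,
          halted ,
          trans out (trans (++-assoc o _ R) (cong (λ x? → o ++ fromMaybe x? ++ R) (storesW i eq)))

  -- Memory layout and total cost.

  module _ (A B S : List Char) where
    private
      start = initial minimise A B S
      a = length A
      m = a + length B
      N = m + length S
      W = A ++ B ++ S

      W≡ : W ≡ (A ++ B) ++ S
      W≡ = sym (++-assoc A B S)

      |W|≡N : length W ≡ N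
      |W|≡N = trans (cong length W≡) (trans (length-++ (A ++ B)) (cong (_+ length S) (length-++ A)))

      end : drop N W ≡ []
      end = drop-all N W (≤-reflexive |W|≡N)

      fromS : drop m W ≡ S
      fromS = trans (cong₂ drop (sym (length-++ A)) W≡) (drop-length-++ (A ++ B) S)

    open Run (chars start) a m N
    open Correctness A (A ++ B) W |W|≡N (stores-++ A (B ++ S))
      (subst (λ W → Stores (λ i → head (drop i W)) (A ++ B)) (sym W≡) (stores-++ (A ++ B) S))
      (λ _ → cong head)

    private
      -- The constant term is `10 + 14 + 3 + 19 = 46`; the linear coefficients, 33 for S and 14 for
      -- A and B, are smaller.
      time : 10 + (14 * suc N + (3 + 19 * suc (length S))) ≤ 46 * suc (length S + length A + length B)
      time = ≤-trans (m≤m+n _ _) (≤-reflexive (lemma a (length B) (length S)))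
        where
        lemma : ∀ a b s → 10 + (14 * suc (a + b + s) + (3 + 19 * suc s)) + (13 * s + 32 * (a + b))
                          ≡ 46 * suc (s + a + b)
        lemma = solve-∀

    minimise-correct : CommonSupersequence A B S →
      ∃[ S′ ] (MinimalCommonSupersequence A B S′ × S′ ⊆ S ×
               OutputsWithin minimise (46 * suc (length S + length A + length B)) A B S S′)
    minimise-correct (A⊆S , B⊆S)
      with p , q , t , w , table , reach₁ ←
        -- At position `N` nothing of S is left, so the thresholds are the full lengths `a` and `m`,
        -- and the table above `N` is vacuous.
        tabulate N a m 0 0 (words start) [] ≤-refl
          (subst (λ s → Threshold A s a) (sym end) (threshold-[] A))
          (subst₂ (Threshold (A ++ B)) (sym end) (length-++ A) (threshold-[] (A ++ B)))
          (λ i N<i i≤N → contradiction i≤N (<⇒≱ N<i))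
      with R , min , R⊆S , f , reach₂ , halted , out ←
        -- `q` starts at `a` because B is the suffix of `A ++ B` from there.
        scan S m 0 a t 0 w [] table fromS A⊆S (subst (_⊆ S) (sym (drop-length-++ A B)) B⊆S)
      with k , k≤ , refl ← steps 10 {start} ▷ reach₁ ▷ steps 3 ▷ reach₂
      = R , subst (λ B → MinimalCommonSupersequence A B R) (drop-length-++ A B) min , R⊆S ,
        k , ≤-trans k≤ time , halted , out

mainTheorem4 : Σ Program λ P → Σ (ℕ → ℕ) λ T → T ∈O id ×
    (∀ {Char : Set} (_≟_ : DecidableEquality Char) (A B S : List Char) →
    CommonSupersequence A B S →
    ∃[ S′ ] (MinimalCommonSupersequence A B S′ ×
    S′ ⊆ S ×
    Machine.OutputsWithin _≟_ P (T (length S + length A + length B)) A B S S′))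
mainTheorem4 = minimise , (λ n → 46 * suc n) , (92 , 1 , linear) , minimise-correct
  where
  linear : ∀ n → 1 ≤ n → 46 * suc n ≤ 92 * n
  linear n 1≤n = begin
    46 * suc n       ≡⟨ *-suc 46 n ⟩
    46 + 46 * n      ≤⟨ +-monoˡ-≤ (46 * n) (*-monoʳ-≤ 46 1≤n) ⟩
    46 * n + 46 * n  ≡⟨ sym (*-distribʳ-+ n 46 46) ⟩
    92 * n           ∎
    where open ≤-Reasoning
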